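{- Let $p$ be a prime, let $K \ge 1$ and $n \ge 1$ be integers with $p^n \ge K$, and let $N = Kp^n+1$. Assume that there exist integers $a$ and $L$ such that: (i) $a^{Kp^{n-1}} \equiv L \pmod N$ and $L \not\equiv 1 \pmod N$, and (ii) $L^p \equiv 1 \pmod N$. Then $N$ is prime. -}

module Defs where

open import Data.Nat.Base using (ℕ)
open import Data.Integer.Base using (ℤ; +_; _-_)
open import Data.Integer.Divisibility.Signed using (_∣_)

infix 4 _≡_[mod_]

_≡_[mod_] : ℤ → ℤ → ℕ → Set
x ≡ y [mod N ] = + N ∣ x - y

{-# OPTIONS --safe #-}

-- Since N is prime to p, the relation Lᵖ ≡ 1 yields a prime q ∣ N with
-- L ≢ 1 (mod q). The order of aᴷ modulo q then divides pⁿ but not pⁿ⁻¹,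
-- so it is pⁿ, and q ≡ 1 (mod pⁿ) by Fermat. The cofactor c = N / q is also
-- 1 modulo pⁿ, and c > 1 would give N ≥ (pⁿ + 1)² > K pⁿ + 1.
module Submission where

open import Defs
open import Data.Nat.Base using (ℕ; _+_; _*_; _∸_; _^_; _≤_)
open import Data.Nat.Primality using (Prime)
open import Data.Integer.Base as ℤ using (ℤ; 1ℤ)
open import Data.Product.Base using (∃₂; _×_)
open import Relation.Nullary.Negation.Core using (¬_)

open import Algebra.Bundles using (CommutativeSemiring; CommutativeRing)
open import Data.Fin.Base as Fin using (zero; suc; toℕ)
import Data.Fin.Properties as Fin
open import Data.Integer.Base using (+_; 0ℤ)
import Data.Integer.DivMod as ℤ
open import Data.Integer.Divisibility.Signed as ℤ using (divides)
import Data.Integer.Properties as ℤ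
open import Data.Integer.Tactic.RingSolver using (solve-∀)
open import Data.Nat.Base as ℕ using (zero; suc; _<_; z≤n; s≤s; NonZero; _!)
open import Data.Nat.Combinatorics using (_C_; nCn≡1; nCk≡n!/k![n-k]!; k![n∸k]!∣n!)
open import Data.Nat.Divisibility as ℕ using (_∣_; _∤_)
open import Data.Nat.DivMod using (m/n*n≡m)
open import Data.Nat.GCD
  using (gcd; gcd[m,n]∣m; gcd[m,n]∣n; gcd-greatest; gcd-GCD; c*gcd[m,n]≡gcd[cm,cn]; module Bézout)
open import Data.Nat.Primality
  using (euclidsLemma; prime⇒irreducible; prime⇒nonZero; ¬prime[1]; ¬prime[0])
open import Data.Nat.Primality.Factorisation using (factorise; PrimeFactorisation)
import Data.Nat.Properties as ℕ
import Data.Nat.Tactic.RingSolver as ℕ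
open import Data.List.Base using ([]; _∷_)
open import Data.Nat.ListAction using (product)
open import Data.List.Relation.Unary.All using ([]; _∷_)
open import Data.Product.Base using (∃; _,_)
open import Data.Sum.Base using (_⊎_; inj₁; inj₂; [_,_]′)
open import Data.Empty using (⊥-elim)
open import Data.Vec.Functional using (Vector; tail; init; last)
open import Function.Base using (_∘_; _$_; id)
open import Relation.Binary.PropositionalEquality
  using (_≡_; _≢_; refl; sym; trans; cong; cong₂; subst; subst₂; module ≡-Reasoning)

private
  ℤ-semiring : CommutativeSemiring _ _
  ℤ-semiring = CommutativeRing.commutativeSemiring ℤ.+-*-commutativeRing

import Algebra.Properties.CommutativeSemiring.Binomial ℤ-semiring as Binomial
open import Algebra.Properties.Semiring.Binomial (CommutativeSemiring.semiring ℤ-semiring)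
  using (binomialTerm)
open import Algebra.Properties.Monoid.Sum ℤ.+-0-monoid using (sum; sum-init-last)
open import Algebra.Definitions.RawSemiring
  (CommutativeSemiring.rawSemiring ℤ-semiring) as Raw using () renaming (_×_ to _×ℤ_)

-- Congruences and powers

module _ {N : ℕ} where

  mod-refl : ∀ x → x ≡ x [mod N ]
  mod-refl x = divides 0ℤ (ℤ.+-inverseʳ x)

  mod-sym : ∀ x y → x ≡ y [mod N ] → y ≡ x [mod N ]
  mod-sym x y N∣x-y = subst (+ N ℤ.∣_) (lemma x y) (ℤ.∣m⇒∣-m N∣x-y)
    where
    lemma : ∀ x y → ℤ.- (x ℤ.- y) ≡ y ℤ.- x
    lemma = solve-∀

  mod-trans : ∀ x y z → x ≡ y [mod N ] → y ≡ z [mod N ] → x ≡ z [mod N ]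
  mod-trans x y z N∣x-y N∣y-z = subst (+ N ℤ.∣_) (lemma x y z) (ℤ.∣m∣n⇒∣m+n N∣x-y N∣y-z)
    where
    lemma : ∀ x y z → (x ℤ.- y) ℤ.+ (y ℤ.- z) ≡ x ℤ.- z
    lemma = solve-∀

  mod-+-congˡ : ∀ x y z → y ≡ z [mod N ] → x ℤ.+ y ≡ x ℤ.+ z [mod N ]
  mod-+-congˡ x y z = subst (+ N ℤ.∣_) (lemma x y z)
    where
    lemma : ∀ x y z → y ℤ.- z ≡ (x ℤ.+ y) ℤ.- (x ℤ.+ z)
    lemma = solve-∀

  mod-*-cong : ∀ x y u v → x ≡ y [mod N ] → u ≡ v [mod N ] → x ℤ.* u ≡ y ℤ.* v [mod N ]
  mod-*-cong x y u v N∣x-y N∣u-v = subst (+ N ℤ.∣_) (lemma x y u v)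
    (ℤ.∣m∣n⇒∣m+n (ℤ.∣n⇒∣m*n x N∣u-v) (ℤ.∣n⇒∣m*n v N∣x-y))
    where
    lemma : ∀ x y u v → x ℤ.* (u ℤ.- v) ℤ.+ v ℤ.* (x ℤ.- y) ≡ x ℤ.* u ℤ.- y ℤ.* v
    lemma = solve-∀

  mod-^-cong : ∀ x y k → x ≡ y [mod N ] → x ℤ.^ k ≡ y ℤ.^ k [mod N ]
  mod-^-cong x y zero    x≡y = mod-refl 1ℤ
  mod-^-cong x y (suc k) x≡y = mod-*-cong x y _ _ x≡y (mod-^-cong x y k x≡y)

  ^-multiple≡1 : ∀ x {u} k → x ℤ.^ u ≡ 1ℤ [mod N ] → x ℤ.^ (k * u) ≡ 1ℤ [mod N ]
  ^-multiple≡1 x {u} k x^u≡1 =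
    subst₂ (λ y z → y ≡ z [mod N ])
      (trans (ℤ.^-*-assoc x u k) (cong (x ℤ.^_) (ℕ.*-comm u k))) (ℤ.^-zeroˡ k)
      (mod-^-cong (x ℤ.^ u) 1ℤ k x^u≡1)

  ^-∣≡1 : ∀ x {u v} → u ∣ v → x ℤ.^ u ≡ 1ℤ [mod N ] → x ℤ.^ v ≡ 1ℤ [mod N ]
  ^-∣≡1 x (ℕ.divides k refl) = ^-multiple≡1 x k

  -- Bézout over the naturals gives `d + e = f`, where one of `e`, `f` is a multiple of `u` and the
  -- other of `v`. Then `x ^ f = x ^ d * x ^ e` reduces to `x ^ d`, without any inverse of `x`. This
  -- takes the place of the multiplicative order.
  ^-gcd≡1 : ∀ x u v → x ℤ.^ u ≡ 1ℤ [mod N ] → x ℤ.^ v ≡ 1ℤ [mod N ] →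
            x ℤ.^ gcd u v ≡ 1ℤ [mod N ]
  ^-gcd≡1 x u v x^u≡1 x^v≡1 = go (Bézout.identity (gcd-GCD u v))
    where
    d = gcd u v

    cancel : ∀ e f → d + e ≡ f → x ℤ.^ e ≡ 1ℤ [mod N ] → x ℤ.^ f ≡ 1ℤ [mod N ] →
             x ℤ.^ d ≡ 1ℤ [mod N ]
    cancel e _ refl x^e≡1 = mod-trans (x ℤ.^ d) (x ℤ.^ (d + e)) 1ℤ
      (mod-sym (x ℤ.^ (d + e)) (x ℤ.^ d) $ subst₂ (λ y z → y ≡ z [mod N ])
        (sym (ℤ.^-distribˡ-+-* x d e)) (ℤ.*-identityʳ (x ℤ.^ d))
        (mod-*-cong (x ℤ.^ d) (x ℤ.^ d) (x ℤ.^ e) 1ℤ (mod-refl (x ℤ.^ d)) x^e≡1))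

    go : Bézout.Identity d u v → x ℤ.^ d ≡ 1ℤ [mod N ]
    go (Bézout.+- k l eq) = cancel (l * v) (k * u) eq (^-multiple≡1 x l x^v≡1) (^-multiple≡1 x k x^u≡1)
    go (Bézout.-+ k l eq) = cancel (k * u) (l * v) eq (^-multiple≡1 x k x^u≡1) (^-multiple≡1 x l x^v≡1)

mod-∣ : ∀ {M N} x y → M ∣ N → x ≡ y [mod N ] → x ≡ y [mod M ]
mod-∣ _ _ M∣N = ℤ.∣-trans (ℤ.∣ᵤ⇒∣ M∣N)

-- Divisors of primes and of prime powers

prime-∤1 : ∀ {p} → Prime p → p ∤ 1
prime-∤1 p-prime p∣1 = ¬prime[1] (subst Prime (ℕ.∣1⇒≡1 p∣1) p-prime)

prime-∣prime⇒≡ : ∀ {p q} → Prime p → Prime q → q ∣ p → q ≡ p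
prime-∣prime⇒≡ p-prime q-prime q∣p with prime⇒irreducible p-prime q∣p
... | inj₁ refl = ⊥-elim (¬prime[1] q-prime)
... | inj₂ q≡p  = q≡p

∃-prime-divisor : ∀ n → n ≢ 0 → n ≢ 1 → ∃ λ p → Prime p × p ∣ n
∃-prime-divisor n n≢0 n≢1 with factorise n {{ℕ.≢-nonZero n≢0}}
... | record { factors = [] ; isFactorisation = n≡1 } = ⊥-elim (n≢1 n≡1)
... | record { factors = p ∷ ps ; isFactorisation = n≡ ; factorsPrime = p-prime ∷ _ } =
  p , p-prime , subst (p ∣_) (sym n≡) (ℕ.m∣m*n (product ps))

-- Induction on `m`, starting from irreducibility of `p`. If `k * t = p ^ suc (suc m)`, then `p`
-- divides `k` or `t`. In the first case cancelling `p` gives the left alternative at once; in the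
-- second it leaves `t / p` as a divisor of `p ^ suc m`, and the induction hypothesis is multiplied
-- back by `p`.
∣prime^⇒ : ∀ {p} → Prime p → ∀ m {t} → t ∣ p ^ suc m → t ∣ p ^ m ⊎ p ^ suc m ∣ t
∣prime^⇒ {p} p-prime zero {t} t∣p
  with prime⇒irreducible p-prime (subst (t ∣_) (ℕ.*-identityʳ p) t∣p)
... | inj₁ refl = inj₁ ℕ.∣-refl
... | inj₂ refl = inj₂ (ℕ.∣-reflexive (ℕ.*-identityʳ p))
∣prime^⇒ {p} p-prime (suc m) {t} (ℕ.divides k p^≡k*t)
  with euclidsLemma k t p-prime (ℕ.divides (p ^ suc m) (trans (sym p^≡k*t) (ℕ.*-comm p _)))
... | inj₁ (ℕ.divides k′ refl) = inj₁ (ℕ.divides k′ (ℕ.*-cancelˡ-≡ _ _ p (trans p^≡k*t (lemma k′ p t))))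
  where
  instance _ = prime⇒nonZero p-prime
  lemma : ∀ k′ p t → k′ * p * t ≡ p * (k′ * t)
  lemma = ℕ.solve-∀
... | inj₂ (ℕ.divides t′ refl)
  with ∣prime^⇒ p-prime m {t′} (ℕ.divides k (ℕ.*-cancelˡ-≡ _ _ p (trans p^≡k*t (lemma k p t′))))
  where
  instance _ = prime⇒nonZero p-prime
  lemma : ∀ k p t′ → k * (t′ * p) ≡ p * (k * t′)
  lemma = ℕ.solve-∀
... | inj₁ t′∣ = inj₁ (subst (t′ * p ∣_) (ℕ.*-comm (p ^ m) p) (ℕ.*-monoˡ-∣ p t′∣))
... | inj₂ ∣t′ = inj₂ (subst (_∣ t′ * p) (ℕ.*-comm (p ^ suc m) p) (ℕ.*-monoˡ-∣ p ∣t′))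

-- Fermat's little theorem

prime-∤! : ∀ {p} → Prime p → ∀ k → k < p → p ∤ k !
prime-∤! p-prime zero    _   = prime-∤1 p-prime
prime-∤! p-prime (suc k) k<p p∣ with euclidsLemma (suc k) (k !) p-prime p∣
... | inj₁ p∣1+k = ℕ.>⇒∤ k<p p∣1+k
... | inj₂ p∣k!  = prime-∤! p-prime k (ℕ.<⇒≤ k<p) p∣k!

-- `p` divides `p ! = (p C k) * (k ! * (p ∸ k) !)`. Both `k` and `p ∸ k` lie below `p`, the latter
-- because `k` is positive, so `p` divides neither factorial.
prime-∣C : ∀ {p k} → Prime p → 0 < k → k < p → p ∣ p C k
prime-∣C {p@(suc r)} {k@(suc l)} p-prime _ k<p
  with euclidsLemma (p C k) (k ! * (p ∸ k) !) p-prime (subst (p ∣_) (sym C*≡!) (ℕ.m∣m*n (r !)))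
  where
  instance _ = k ℕ.!* (p ∸ k) !≢0
  C*≡! : (p C k) * (k ! * (p ∸ k) !) ≡ p !
  C*≡! = trans (cong (_* (k ! * (p ∸ k) !)) (nCk≡n!/k![n-k]! (ℕ.<⇒≤ k<p))) (m/n*n≡m (k![n∸k]!∣n! (ℕ.<⇒≤ k<p)))
... | inj₁ p∣C = p∣C
... | inj₂ p∣!! with euclidsLemma (k !) _ p-prime p∣!!
...   | inj₁ p∣k! = ⊥-elim (prime-∤! p-prime k k<p p∣k!)
...   | inj₂ p∣!  = ⊥-elim (prime-∤! p-prime (p ∸ k) (s≤s (ℕ.m∸n≤m r l)) p∣!)

-- This and `raw-^≡^` translate the scalar multiples and powers of a general semiring, in which the
-- binomial theorem is stated, into integer arithmetic.
×≡* : ∀ n x → n ×ℤ x ≡ + n ℤ.* x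
×≡* zero    x = refl
×≡* (suc n) x = trans (cong (λ y → x ℤ.+ y) (×≡* n x)) (sym (ℤ.suc-* (+ n) x))

raw-^≡^ : ∀ x n → x Raw.^ n ≡ x ℤ.^ n
raw-^≡^ x zero    = refl
raw-^≡^ x (suc n) = cong (x ℤ.*_) (raw-^≡^ x n)

∣-sum : ∀ {d n} (t : Vector ℤ n) → (∀ i → d ℤ.∣ t i) → d ℤ.∣ sum t
∣-sum {n = zero}  t d∣t = divides 0ℤ refl
∣-sum {n = suc n} t d∣t = ℤ.∣m∣n⇒∣m+n (d∣t zero) (∣-sum (tail t) (d∣t ∘ suc))

-- In the binomial expansion the two outer terms are `y ^ p` and `x ^ p`; every other coefficient is
-- divisible by `p`.
prime-^-+ : ∀ {p} → Prime p → ∀ x y → (x ℤ.+ y) ℤ.^ p ≡ x ℤ.^ p ℤ.+ y ℤ.^ p [mod p ]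
prime-^-+ {zero} p-prime = ⊥-elim (¬prime[0] p-prime)
prime-^-+ {p@(suc r)} p-prime x y = subst (+ p ℤ.∣_) (sym difference) (∣-sum middle p∣middle)
  where
  open ≡-Reasoning

  term : Vector ℤ (suc p)
  term = binomialTerm x y p

  -- Dropping both ends leaves the indices 1 to `p ∸ 1`, so `middle i` belongs to `k = suc (toℕ i)`.
  middle : Vector ℤ r
  middle = init (tail term)

  p∣middle : ∀ i → + p ℤ.∣ middle i
  p∣middle i = subst (+ p ℤ.∣_) (sym (×≡* (p C k) z))
    (ℤ.∣m⇒∣m*n {m = + (p C k)} z (ℤ.∣ᵤ⇒∣ (prime-∣C p-prime (s≤s z≤n) k<p)))
    where
    k = suc (toℕ (Fin.inject₁ i))
    z = x Raw.^ k ℤ.* y Raw.^ (p ∸ k)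
    k<p : k < p
    k<p = s≤s (subst (_< r) (sym (Fin.toℕ-inject₁ i)) (Fin.toℕ<n i))

  first : term zero ≡ y ℤ.^ p
  first = begin
    1ℤ ℤ.* (y Raw.^ p) ℤ.+ 0ℤ ≡⟨ ℤ.+-identityʳ _ ⟩
    1ℤ ℤ.* (y Raw.^ p)        ≡⟨ ℤ.*-identityˡ _ ⟩
    y Raw.^ p                 ≡⟨ raw-^≡^ y p ⟩
    y ℤ.^ p                   ∎

  final : last (tail term) ≡ x ℤ.^ p
  -- The last index is `p`: the coefficient becomes `p C p = 1` and the exponent of `y` becomes 0.
  final rewrite Fin.toℕ-fromℕ r | nCn≡1 p | ℕ.n∸n≡0 r = begin
    (x Raw.^ p) ℤ.* 1ℤ ℤ.+ 0ℤ ≡⟨ ℤ.+-identityʳ _ ⟩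
    (x Raw.^ p) ℤ.* 1ℤ        ≡⟨ ℤ.*-identityʳ _ ⟩
    x Raw.^ p                 ≡⟨ raw-^≡^ x p ⟩
    x ℤ.^ p                   ∎

  expansion : (x ℤ.+ y) ℤ.^ p ≡ y ℤ.^ p ℤ.+ (sum middle ℤ.+ x ℤ.^ p)
  expansion = begin
    (x ℤ.+ y) ℤ.^ p                                  ≡⟨ raw-^≡^ (x ℤ.+ y) p ⟨
    (x ℤ.+ y) Raw.^ p                                ≡⟨ Binomial.theorem p x y ⟩
    term zero ℤ.+ sum (tail term)                    ≡⟨ cong₂ ℤ._+_ first (sum-init-last (tail term)) ⟩
    y ℤ.^ p ℤ.+ (sum middle ℤ.+ last (tail term))    ≡⟨ cong (λ z → y ℤ.^ p ℤ.+ (sum middle ℤ.+ z)) final ⟩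
    y ℤ.^ p ℤ.+ (sum middle ℤ.+ x ℤ.^ p)             ∎

  difference : (x ℤ.+ y) ℤ.^ p ℤ.- (x ℤ.^ p ℤ.+ y ℤ.^ p) ≡ sum middle
  difference = trans (cong (ℤ._- (x ℤ.^ p ℤ.+ y ℤ.^ p)) expansion) (lemma (y ℤ.^ p) (sum middle) (x ℤ.^ p))
    where
    lemma : ∀ u m v → (u ℤ.+ (m ℤ.+ v)) ℤ.- (v ℤ.+ u) ≡ m
    lemma = solve-∀

-- Induction on `n`: modulo `p`, `(1 + n) ^ p` is `1 + n ^ p`.
fermat-ℕ : ∀ {p} → Prime p → ∀ n → (+ n) ℤ.^ p ≡ + n [mod p ]
fermat-ℕ {zero} p-prime = ⊥-elim (¬prime[0] p-prime)
fermat-ℕ {suc _} p-prime zero = mod-refl 0ℤ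
fermat-ℕ {p@(suc _)} p-prime (suc n) = mod-trans ((+ suc n) ℤ.^ p) (1ℤ ℤ.^ p ℤ.+ (+ n) ℤ.^ p) (+ suc n)
  (prime-^-+ p-prime 1ℤ (+ n))
  (subst (λ z → z ℤ.+ (+ n) ℤ.^ p ≡ + suc n [mod p ]) (sym (ℤ.^-zeroˡ p))
    (mod-+-congˡ 1ℤ ((+ n) ℤ.^ p) (+ n) (fermat-ℕ p-prime n)))

mod-%ℕ : ∀ x n .{{_ : NonZero n}} → x ≡ + (x ℤ.%ℕ n) [mod n ]
mod-%ℕ x n = divides (x ℤ./ℕ n)
  (trans (cong (ℤ._- r) (ℤ.a≡a%ℕn+[a/ℕn]*n x n)) (lemma r ((x ℤ./ℕ n) ℤ.* + n)))
  where
  r = + (x ℤ.%ℕ n)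
  lemma : ∀ r y → (r ℤ.+ y) ℤ.- r ≡ y
  lemma = solve-∀

-- Passing to the nonnegative remainder of `x` reduces to the naturals, where the induction was
-- made.
fermat : ∀ {p} → Prime p → ∀ x → x ℤ.^ p ≡ x [mod p ]
fermat {p} p-prime x = mod-trans (x ℤ.^ p) (r ℤ.^ p) x (mod-^-cong x r p x≡r)
  (mod-trans (r ℤ.^ p) r x (fermat-ℕ p-prime _) (mod-sym x r x≡r))
  where
  instance _ = prime⇒nonZero p-prime
  r = + (x ℤ.%ℕ p)
  x≡r = mod-%ℕ x p

prime-∣* : ∀ {p} → Prime p → ∀ x y → + p ℤ.∣ x ℤ.* y → + p ℤ.∣ x ⊎ + p ℤ.∣ y
prime-∣* {p} p-prime x y p∣xy
  with euclidsLemma ℤ.∣ x ∣ ℤ.∣ y ∣ p-prime (subst (p ∣_) (ℤ.abs-* x y) (ℤ.∣⇒∣ᵤ p∣xy))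
... | inj₁ p∣x = inj₁ (ℤ.∣ᵤ⇒∣ p∣x)
... | inj₂ p∣y = inj₂ (ℤ.∣ᵤ⇒∣ p∣y)

fermat-unit : ∀ {p} → Prime p → ∀ x → ¬ (+ p ℤ.∣ x) → x ℤ.^ (p ∸ 1) ≡ 1ℤ [mod p ]
fermat-unit {zero} p-prime = ⊥-elim (¬prime[0] p-prime)
fermat-unit {p@(suc r)} p-prime x p∤x =
  [ ⊥-elim ∘ p∤x , id ]′
    (prime-∣* p-prime x (x ℤ.^ r ℤ.- 1ℤ) (subst (+ p ℤ.∣_) (lemma x (x ℤ.^ r)) (fermat p-prime x)))
  where
  lemma : ∀ x y → x ℤ.* y ℤ.- x ≡ x ℤ.* (y ℤ.- 1ℤ)
  lemma = solve-∀

-- Since `k` is positive, a divisor of `x` divides `x ^ k`; dividing `x ^ k - 1` too, it would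
-- divide 1. This supplies the hypothesis of `fermat-unit`.
^≡1⇒∤ : ∀ {p} → Prime p → ∀ x k .{{_ : NonZero k}} → x ℤ.^ k ≡ 1ℤ [mod p ] → ¬ (+ p ℤ.∣ x)
^≡1⇒∤ p-prime x (suc k) x^k≡1 p∣x = prime-∤1 p-prime (ℤ.∣⇒∣ᵤ
  (subst (_ ℤ.∣_) (lemma (x ℤ.^ suc k)) (ℤ.∣m∣n⇒∣m-n (ℤ.∣m⇒∣m*n (x ℤ.^ k) p∣x) x^k≡1)))
  where
  lemma : ∀ y → y ℤ.- (y ℤ.- 1ℤ) ≡ 1ℤ
  lemma = solve-∀

-- Prime divisors of N

-- The binomial expansion to first order, with `t` collecting all later terms. At `x = L - 1` it
-- exhibits the cofactor of `L - 1` in `L ^ n - 1` as `n` modulo `L - 1`.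
1+x-^ : ∀ x n → ∃ λ t → (1ℤ ℤ.+ x) ℤ.^ n ≡ 1ℤ ℤ.+ x ℤ.* (+ n ℤ.+ x ℤ.* t)
1+x-^ x zero = 0ℤ , lemma x
  where
  lemma : ∀ x → 1ℤ ≡ 1ℤ ℤ.+ x ℤ.* (0ℤ ℤ.+ x ℤ.* 0ℤ)
  lemma = solve-∀
1+x-^ x (suc n) with 1+x-^ x n
... | t , eq = t ℤ.+ + n ℤ.+ x ℤ.* t , trans (cong ((1ℤ ℤ.+ x) ℤ.*_) eq) (lemma x (+ n) t)
  where
  lemma : ∀ x n t → (1ℤ ℤ.+ x) ℤ.* (1ℤ ℤ.+ x ℤ.* (n ℤ.+ x ℤ.* t))
                  ≡ 1ℤ ℤ.+ x ℤ.* ((1ℤ ℤ.+ n) ℤ.+ x ℤ.* (t ℤ.+ n ℤ.+ x ℤ.* t))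
  lemma = solve-∀

-- A prime q dividing N / gcd(N, L - 1) works: writing Lᵖ - 1 = (L - 1)(p + (L - 1) t),
-- it divides the second factor, so q ∣ L - 1 would force q ∣ p.
∃-prime-≢1 : ∀ {p N} → Prime p → p ∤ N → .{{_ : NonZero N}} → ∀ L →
             ¬ (L ≡ 1ℤ [mod N ]) → L ℤ.^ p ≡ 1ℤ [mod N ] →
             ∃ λ q → Prime q × q ∣ N × ¬ (L ≡ 1ℤ [mod q ])
∃-prime-≢1 {p} {N} p-prime p∤N L L≢1 L^p≡1 with gcd[m,n]∣m N ℤ.∣ L ℤ.- 1ℤ ∣ | 1+x-^ (L ℤ.- 1ℤ) p
... | ℕ.divides m N≡m*g | t , eq with ∃-prime-divisor m m≢0 m≢1
  where
  g = gcd N ℤ.∣ L ℤ.- 1ℤ ∣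
  m≢0 : m ≢ 0
  m≢0 refl = ℕ.≢-nonZero⁻¹ N N≡m*g
  -- If `m` were 1, then `N = g` would divide `L - 1`.
  m≢1 : m ≢ 1
  m≢1 refl = L≢1 (ℤ.∣ᵤ⇒∣ (subst (_∣ ℤ.∣ L ℤ.- 1ℤ ∣)
    (sym (trans N≡m*g (ℕ.*-identityˡ g))) (gcd[m,n]∣n N ℤ.∣ L ℤ.- 1ℤ ∣)))
... | q , q-prime , q∣m = q , q-prime , q∣N , q∤x
  where
  x = L ℤ.- 1ℤ
  u = + p ℤ.+ x ℤ.* t
  g = gcd N ℤ.∣ x ∣

  instance
    g≢0 : NonZero g
    g≢0 = ℕ.≢-nonZero λ g≡0 →
      ℕ.≢-nonZero⁻¹ N (trans N≡m*g (trans (cong (m *_) g≡0) (ℕ.*-zeroʳ m)))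

  q∣N : q ∣ N
  q∣N = ℕ.∣-trans q∣m (subst (m ∣_) (sym N≡m*g) (ℕ.m∣m*n g))

  L^p-1≡u*x : L ℤ.^ p ℤ.- 1ℤ ≡ u ℤ.* x
  L^p-1≡u*x = begin
    L ℤ.^ p ℤ.- 1ℤ          ≡⟨ cong (λ y → y ℤ.^ p ℤ.- 1ℤ) (lemma₁ L) ⟩
    (1ℤ ℤ.+ x) ℤ.^ p ℤ.- 1ℤ ≡⟨ cong (ℤ._- 1ℤ) eq ⟩
    1ℤ ℤ.+ x ℤ.* u ℤ.- 1ℤ   ≡⟨ lemma₂ x u ⟩
    u ℤ.* x                 ∎
    where
    open ≡-Reasoning
    lemma₁ : ∀ L → L ≡ 1ℤ ℤ.+ (L ℤ.- 1ℤ)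
    lemma₁ = solve-∀
    lemma₂ : ∀ x u → 1ℤ ℤ.+ x ℤ.* u ℤ.- 1ℤ ≡ u ℤ.* x
    lemma₂ = solve-∀

  N∣u*x : N ∣ ℤ.∣ u ∣ * ℤ.∣ x ∣
  N∣u*x = subst (N ∣_) (trans (cong ℤ.∣_∣ L^p-1≡u*x) (ℤ.abs-* u x)) (ℤ.∣⇒∣ᵤ L^p≡1)

  -- `N` divides both `∣u∣ * N` and `∣u∣ * ∣x∣`, hence their gcd `∣u∣ * g`. As `N = m * g`,
  -- cancelling `g` leaves the claim.
  m∣u : m ∣ ℤ.∣ u ∣
  m∣u = ℕ.*-cancelʳ-∣ g (subst₂ _∣_ N≡m*g (sym (c*gcd[m,n]≡gcd[cm,cn] ℤ.∣ u ∣ N ℤ.∣ x ∣))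
    (gcd-greatest (ℕ.n∣m*n ℤ.∣ u ∣) N∣u*x))

  q∤x : ¬ (+ q ℤ.∣ x)
  q∤x q∣x = p∤N (subst (_∣ N) q≡p q∣N)
    where
    q∣p : + q ℤ.∣ + p
    q∣p = ℤ.∣m+n∣n⇒∣m {m = + p} (ℤ.∣ᵤ⇒∣ (ℕ.∣-trans q∣m m∣u)) (ℤ.∣m⇒∣m*n t q∣x)
    q≡p = prime-∣prime⇒≡ p-prime q-prime (ℤ.∣⇒∣ᵤ q∣p)

-- By the hypothesis and Fermat, `b` raised to `gcd (p ^ suc m) (q ∸ 1)` is 1 modulo `q`. If this
-- gcd divided `p ^ m`, the excluded congruence would follow; so `p ^ suc m` divides the gcd.
prime^∣q-1 : ∀ {p q} → Prime p → Prime q → ∀ b m → b ℤ.^ (p ^ suc m) ≡ 1ℤ [mod q ] →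
             ¬ (b ℤ.^ (p ^ m) ≡ 1ℤ [mod q ]) → p ^ suc m ∣ q ∸ 1
prime^∣q-1 {p} {q} p-prime q-prime b m b^≡1 b^≢1
  with ∣prime^⇒ p-prime m (gcd[m,n]∣m (p ^ suc m) (q ∸ 1))
... | inj₂ p^∣gcd = ℕ.∣-trans p^∣gcd (gcd[m,n]∣n (p ^ suc m) (q ∸ 1))
... | inj₁ gcd∣p^ = ⊥-elim (b^≢1 (^-∣≡1 b gcd∣p^
  (^-gcd≡1 b (p ^ suc m) (q ∸ 1) b^≡1 (fermat-unit q-prime b (^≡1⇒∤ q-prime b (p ^ suc m) b^≡1)))))
  where
  instance
    _ = prime⇒nonZero p-prime
    _ = ℕ.m^n≢0 p (suc m)

-- Size of the cofactor

-- Reducing the equation modulo `P` shows `P ∣ c - 1`. If `c` is not 1, then `c = 1 + suc r * P`,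
-- and dividing out `P` gives `K = c * s + suc r`, which exceeds `P` because `s` is positive.
cofactor≡1 : ∀ P K c s → .{{_ : NonZero P}} → .{{_ : NonZero s}} → K ≤ P →
             K * P + 1 ≡ c * suc (s * P) → c ≡ 1
cofactor≡1 P K zero s K≤P eq = ⊥-elim (ℕ.1+n≢0 (trans (ℕ.+-comm 1 (K * P)) eq))
cofactor≡1 P K (suc c′) s K≤P eq with P∣c′
  where
  eq′ : K * P ≡ suc c′ * s * P + c′
  eq′ = ℕ.+-cancelʳ-≡ 1 _ _ (trans eq (lemma c′ s P))
    where
    lemma : ∀ c′ s P → suc c′ * suc (s * P) ≡ suc c′ * s * P + c′ + 1
    lemma = ℕ.solve-∀
  P∣c′ : P ∣ c′
  P∣c′ = ℕ.∣m+n∣m⇒∣n (subst (P ∣_) eq′ (ℕ.n∣m*n K)) (ℕ.n∣m*n (suc c′ * s))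
... | ℕ.divides zero    refl = refl
... | ℕ.divides (suc r) refl = ⊥-elim (ℕ.<⇒≱ P<K K≤P)
  where
  K≡ : K ≡ suc (suc r * P) * s + suc r
  K≡ = ℕ.*-cancelʳ-≡ _ _ P (ℕ.+-cancelʳ-≡ 1 _ _ (trans eq (lemma r s P)))
    where
    lemma : ∀ r s P → suc (suc r * P) * suc (s * P) ≡ (suc (suc r * P) * s + suc r) * P + 1
    lemma = ℕ.solve-∀
  P<K : P < K
  P<K = begin-strict
    P                            ≤⟨ ℕ.m≤m+n P (r * P) ⟩
    suc r * P                    <⟨ ℕ.n<1+n _ ⟩
    suc (suc r * P)              ≤⟨ ℕ.m≤m*n _ s ⟩
    suc (suc r * P) * s          ≤⟨ ℕ.m≤m+n _ (suc r) ⟩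
    suc (suc r * P) * s + suc r  ≡⟨ K≡ ⟨
    K                            ∎
    where open ℕ.≤-Reasoning

-- Write `q = 1 + s * P`. Here `s = 0` would make `q` equal to 1; otherwise the cofactor of `q` is 1
-- and the number is `q` itself.
prime-of-divisor≡1 : ∀ {P K q} → .{{_ : NonZero P}} → K ≤ P → Prime q → q ∣ K * P + 1 → P ∣ q ∸ 1 →
                     Prime (K * P + 1)
prime-of-divisor≡1 {q = zero}  _ q-prime _ _ = ⊥-elim (¬prime[0] q-prime)
prime-of-divisor≡1 {q = suc _} _ q-prime _ (ℕ.divides zero refl) = ⊥-elim (¬prime[1] q-prime)
prime-of-divisor≡1 {P} {K} {suc _} K≤P q-prime (ℕ.divides c eq) (ℕ.divides s@(suc _) refl) =
  subst Prime (sym (trans eq (trans (cong (_* suc (s * P)) (cofactor≡1 P K c s K≤P eq)) (ℕ.*-identityˡ _)))) q-prime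

theorem2p3 : ∀ (p K n : ℕ) → Prime p → 1 ≤ K → 1 ≤ n → K ≤ p ^ n →
    let N = K * p ^ n + 1 in
    (∃₂ λ (a L : ℤ) →
    (a ℤ.^ (K * p ^ (n ∸ 1))) ≡ L [mod N ] ×
    ¬ (L ≡ 1ℤ [mod N ]) ×
    (L ℤ.^ p) ≡ 1ℤ [mod N ]) →
    Prime N
theorem2p3 p K (suc m) p-prime 1≤K (s≤s _) K≤P (a , L , a^≡L , L≢1 , L^p≡1)
  with ∃-prime-≢1 {N = K * p ^ suc m + 1} p-prime p∤N {{N≢0}} L L≢1 L^p≡1
  where
  N≢0 : NonZero (K * p ^ suc m + 1)
  N≢0 = ℕ.≢-nonZero (ℕ.m+1+n≢0 (K * p ^ suc m))
  p∤N : p ∤ K * p ^ suc m + 1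
  p∤N p∣N = prime-∤1 p-prime (ℕ.∣m+n∣m⇒∣n p∣N (ℕ.∣n⇒∣m*n K (ℕ.m∣m*n (p ^ m))))
... | q , q-prime , q∣N , L≢1[q] =
  prime-of-divisor≡1 K≤P q-prime q∣N (prime^∣q-1 p-prime q-prime b m b^P≡1 b^≢1)
  where
  instance
    _ = prime⇒nonZero p-prime
    _ = ℕ.m^n≢0 p (suc m)

  -- With `n = suc m`, the power `b ^ (p ^ m)` is `a ^ (K * p ^ m)`, which is `L`; its `p`-th power
  -- is then 1 modulo `q`.
  b = a ℤ.^ K
  y = b ℤ.^ (p ^ m)

  y≡L : y ≡ L [mod q ]
  y≡L = mod-∣ y L q∣N
    (subst (λ z → z ≡ L [mod K * p ^ suc m + 1 ]) (sym (ℤ.^-*-assoc a K (p ^ m))) a^≡L)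

  b^≢1 : ¬ (y ≡ 1ℤ [mod q ])
  b^≢1 y≡1 = L≢1[q] (mod-trans L y 1ℤ (mod-sym y L y≡L) y≡1)

  b^P≡1 : b ℤ.^ (p ^ suc m) ≡ 1ℤ [mod q ]
  b^P≡1 = subst (λ z → z ≡ 1ℤ [mod q ])
    (trans (ℤ.^-*-assoc b (p ^ m) p) (cong (b ℤ.^_) (ℕ.*-comm (p ^ m) p)))
    (mod-trans (y ℤ.^ p) (L ℤ.^ p) 1ℤ (mod-^-cong y L p y≡L) (mod-∣ (L ℤ.^ p) 1ℤ q∣N L^p≡1))
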